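{- For any integer $k\geq 1$ and $n=2^k$, there exists a twin-free graph $G$ of order $n$ with $\text{max-sep}_{RB}(G)=k$.
   Context: All graphs are finite, simple and undirected. $N[x]$ denotes the closed neighborhood of $x$. A graph is twin-free if no two distinct vertices have the same closed neighborhood. A red-blue coloring of $G$ is a map $c:V(G)\to\{\text{red},\text{blue}\}$. A red-blue separating set of $(G,c)$ is a set $S\subseteq V(G)$ such that $N[r]\cap S\neq N[b]\cap S$ for every red vertex $r$ and every blue vertex $b$. For $G$ twin-free, $\mathrm{sep}_{RB}(G,c)$ is the smallest size of a red-blue separating set of $(G,c)$, and $\text{max-sep}_{RB}(G)$ is the maximum of $\mathrm{sep}_{RB}(G,c)$ over all red-blue colorings $c$ of $G$. -}

module Defs where

open import Data.Fin using (Fin; _≟_)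
open import Data.Fin.Subset using (Subset; _∩_; ∣_∣)
open import Data.Nat using (ℕ; _≤_)
open import Data.Product using (∃-syntax; _×_)
open import Data.Vec using (tabulate)
open import Level using (0ℓ)
open import Relation.Binary.Core using (Rel)
open import Relation.Binary.Definitions using (Decidable; Irreflexive; Symmetric)
open import Relation.Binary.PropositionalEquality using (_≡_; _≢_)
open import Relation.Nullary.Decidable using (does; _⊎-dec_)
open import Relation.Unary using (Pred)

record Graph (n : ℕ) : Set₁ where
  field
    Adj    : Rel (Fin n) 0ℓ
    adj?   : Decidable Adj
    sym    : Symmetric Adj
    irrefl : Irreflexive _≡_ Adj

N[_] : ∀ {n} → Graph n → Fin n → Subset n
N[ G ] x = tabulate λ y → does ((y ≟ x) ⊎-dec adj? x y)
  where open Graph G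

TwinFree : ∀ {n} → Graph n → Set
TwinFree G = ∀ x y → x ≢ y → N[ G ] x ≢ N[ G ] y

data Colour : Set where
  red blue : Colour

Colouring : ∀ {n} → Graph n → Set
Colouring {n} _ = Fin n → Colour

RBSeparating : ∀ {n} (G : Graph n) → Colouring G → Pred (Subset n) 0ℓ
RBSeparating G c S =
  ∀ r b → c r ≡ red → c b ≡ blue → N[ G ] r ∩ S ≢ N[ G ] b ∩ S

IsLeast : Pred ℕ 0ℓ → Pred ℕ 0ℓ
IsLeast P m = P m × (∀ {i} → P i → m ≤ i)

IsGreatest : Pred ℕ 0ℓ → Pred ℕ 0ℓ
IsGreatest P m = P m × (∀ {i} → P i → i ≤ m)

-- `sepRB G , c ≔ m` and `maxSepRB G ≔ k` are the graphs of the partial functions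
-- sep_RB and max-sep_RB.  When G is twin-free the full vertex set separates
-- every colouring, so each colouring has exactly one value of sep_RB.

sepRB_,_≔_ : ∀ {n} (G : Graph n) → Colouring G → Pred ℕ 0ℓ
sepRB G , c ≔ m = IsLeast (λ i → ∃[ S ] RBSeparating G c S × ∣ S ∣ ≡ i) m

maxSepRB_≔_ : ∀ {n} → Graph n → Pred ℕ 0ℓ
maxSepRB G ≔ k = IsGreatest (λ m → ∃[ c ] (sepRB G , c ≔ m)) k

{-# OPTIONS --safe #-}

-- Take the subsets of a k-element set as vertices and join two distinct ones x, y
-- whenever "x = {i} implies i ∈ y, and y = {i} implies i ∈ x".  Then {i} ∈ N[x] iff
-- i ∈ x, so the k singletons separate all vertices.  Conversely colour only the
-- full set red.  For k ≥ 3 neither the full set nor the complement of {i} is a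
-- singleton, so their closed neighbourhoods differ only in {i}, which forces
-- every singleton into a separating set; k ≤ 2 is a finite check.
module Submission where

open import Data.Bool using (true; if_then_else_)
open import Data.Fin using (Fin; zero; suc; _≟_; finToFun; funToFin; combine; punchIn)
open import Data.Fin.Patterns using (0F; 1F; 2F; 3F)
open import Data.Fin.Properties
  using (all?; combine-remQuot; finToFun-funToFin; punchIn-injective; punchInᵢ≢i; suc-injective)
open import Data.Fin.Subset using (Subset; _∈_; _⊆_; _∩_; _∪_; _-_; ∣_∣; ⊥; ⁅_⁆; inside; outside)
open import Data.Fin.Subset.Properties
  using ( ∣⊥∣≡0; ∣⁅x⁆∣≡1; x∈⁅x⁆; x∈p∪q⁺; x∈p∩q⁺; x∈p∩q⁻; ⊆-antisym; _∈?_
        ; x∈p∧x≢y⇒x∈p-y; x∈p⇒∣p-x∣<∣p∣)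
open import Data.Nat using (ℕ; zero; suc; _+_; _≤_; _≥_; _^_; z≤n; s≤s)
open import Data.Nat.Properties
  using (≤-reflexive; ≤-trans; ≤-antisym; +-mono-≤; +-suc; m≤n⇒m≤1+n)
open import Data.Product using (Σ-syntax; _×_; _,_; proj₁)
open import Data.Sum using (_⊎_; inj₁; inj₂)
open import Data.Vec using ([]; _∷_)
open import Data.Vec.Properties using ([]=⇒lookup; lookup⇒[]=; lookup∘tabulate)
open import Function using (_∘_; Injective)
open import Level using (0ℓ)
open import Relation.Binary.PropositionalEquality
  using (_≡_; _≢_; refl; sym; trans; cong; cong₂; subst)
open import Relation.Nullary using (¬_; Dec; yes; no; contradiction)
open import Relation.Nullary.Decidable
  using (does; ¬?; _×-dec_; _→-dec_; _⊎-dec_; dec-true; dec-false; decidable-stable)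
open import Relation.Unary using (Pred; Decidable)
open import Relation.Unary.Properties using (U?)
open import Defs

private variable
  k n : ℕ

-- Cardinality of subsets and of images.

∣p∪q∣≤∣p∣+∣q∣ : (p q : Subset n) → ∣ p ∪ q ∣ ≤ ∣ p ∣ + ∣ q ∣
∣p∪q∣≤∣p∣+∣q∣ []            []            = z≤n
∣p∪q∣≤∣p∣+∣q∣ (outside ∷ p) (outside ∷ q) = ∣p∪q∣≤∣p∣+∣q∣ p q
∣p∪q∣≤∣p∣+∣q∣ (outside ∷ p) (inside  ∷ q) =
  subst (suc ∣ p ∪ q ∣ ≤_) (sym (+-suc ∣ p ∣ ∣ q ∣)) (s≤s (∣p∪q∣≤∣p∣+∣q∣ p q))
∣p∪q∣≤∣p∣+∣q∣ (inside  ∷ p) (outside ∷ q) = s≤s (∣p∪q∣≤∣p∣+∣q∣ p q)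
∣p∪q∣≤∣p∣+∣q∣ (inside  ∷ p) (inside  ∷ q) =
  s≤s (subst (∣ p ∪ q ∣ ≤_) (sym (+-suc ∣ p ∣ ∣ q ∣)) (m≤n⇒m≤1+n (∣p∪q∣≤∣p∣+∣q∣ p q)))

image : (Fin k → Fin n) → Subset n
image {zero}  f = ⊥
image {suc k} f = ⁅ f zero ⁆ ∪ image (f ∘ suc)

∈-image : (f : Fin k → Fin n) (i : Fin k) → f i ∈ image f
∈-image f zero    = x∈p∪q⁺ (inj₁ (x∈⁅x⁆ (f zero)))
∈-image f (suc i) = x∈p∪q⁺ (inj₂ (∈-image (f ∘ suc) i))

∣image∣≤ : (f : Fin k → Fin n) → ∣ image f ∣ ≤ k
∣image∣≤ {zero}  {n} f = ≤-reflexive (∣⊥∣≡0 n)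
∣image∣≤ {suc k}     f = ≤-trans (∣p∪q∣≤∣p∣+∣q∣ ⁅ f zero ⁆ (image (f ∘ suc)))
  (+-mono-≤ (≤-reflexive (∣⁅x⁆∣≡1 (f zero))) (∣image∣≤ (f ∘ suc)))

injective⇒≤∣p∣ : (f : Fin k → Fin n) → Injective _≡_ _≡_ f →
                 (p : Subset n) → (∀ i → f i ∈ p) → k ≤ ∣ p ∣
injective⇒≤∣p∣ {zero}  f inj p f∈p = z≤n
injective⇒≤∣p∣ {suc k} f inj p f∈p = ≤-trans
  -- Injectivity keeps the other values of `f` in `p - f zero`, a strictly smaller set.
  (s≤s (injective⇒≤∣p∣ (f ∘ suc) (suc-injective ∘ inj) (p - f zero)
    λ i → x∈p∧x≢y⇒x∈p-y (f∈p (suc i)) λ eq → contradiction (inj eq) λ ()))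
  (x∈p⇒∣p-x∣<∣p∣ (f∈p zero))

-- Membership in traces and closed neighbourhoods.

∩-cong-∈ : {p q s : Subset n} → (∀ {z} → z ∈ s → z ∈ p → z ∈ q) → p ∩ s ⊆ q ∩ s
∩-cong-∈ {p = p} {s = s} h z∈p∩s with x∈p∩q⁻ p s z∈p∩s
... | z∈p , z∈s = x∈p∩q⁺ (h z∈s z∈p , z∈s)

∩-≡⇒∈ : {p q s : Subset n} {z : Fin n} → p ∩ s ≡ q ∩ s → z ∈ s → z ∈ p → z ∈ q
∩-≡⇒∈ {q = q} {s} {z} eq z∈s z∈p = proj₁ (x∈p∩q⁻ q s (subst (z ∈_) eq (x∈p∩q⁺ (z∈p , z∈s))))

does⇒witness : {A : Set} (a? : Dec A) → does a? ≡ true → A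
does⇒witness (yes a) _ = a

module _ (G : Graph n) where
  open Graph G using (Adj; adj?)

  ∈N⁺ : ∀ x {y} → y ≡ x ⊎ Adj x y → y ∈ N[ G ] x
  ∈N⁺ x {y} h = lookup⇒[]= y _
    (trans (lookup∘tabulate _ y) (dec-true ((y ≟ x) ⊎-dec adj? x y) h))

  ∈N⁻ : ∀ x {y} → y ∈ N[ G ] x → y ≡ x ⊎ Adj x y
  ∈N⁻ x {y} y∈N = does⇒witness ((y ≟ x) ⊎-dec adj? x y)
    (trans (sym (lookup∘tabulate _ y)) ([]=⇒lookup y∈N))

-- Numbers determined by their digits.

finToFun-injective : ∀ {m} n {x y : Fin (m ^ n)} →
                         (∀ i → finToFun {m} {n} x i ≡ finToFun y i) → x ≡ y
finToFun-injective zero {zero} {zero} h = refl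
-- Both numbers are rebuilt from leading digit and remainder; the remainders agree by induction on
-- the number of digits.
finToFun-injective {m} (suc n) {x} {y} h = trans (sym (combine-remQuot {m} (m ^ n) x))
  (trans (cong₂ combine (h zero) (finToFun-injective n (h ∘ suc)))
         (combine-remQuot {m} (m ^ n) y))

1F-ext : {a b : Fin 2} → (a ≡ 1F → b ≡ 1F) → (b ≡ 1F → a ≡ 1F) → a ≡ b
1F-ext {0F} {0F} f g = refl
1F-ext {0F} {1F} f g = g refl
1F-ext {1F} {b}  f g = sym (f refl)

-- The graph on subsets and its upper bound.

module Construction (k : ℕ) where

  -- A vertex encodes, through its base 2 digits, a subset of Fin k.
  Vertex : Set
  Vertex = Fin (2 ^ k)

  _∋_ : Vertex → Fin k → Set
  x ∋ i = finToFun {2} {k} x i ≡ 1F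

  ∋-ext : ∀ {x y} → (∀ i → x ∋ i → y ∋ i) → (∀ i → y ∋ i → x ∋ i) → x ≡ y
  ∋-ext x⊆y y⊆x = finToFun-injective k λ i → 1F-ext (x⊆y i) (y⊆x i)

  encode : {P : Pred (Fin k) 0ℓ} → Decidable P → Vertex
  encode P? = funToFin λ i → if does (P? i) then 1F else 0F

  module _ {P : Pred (Fin k) 0ℓ} (P? : Decidable P) where

    encode⁺ : ∀ {i} → P i → encode P? ∋ i
    encode⁺ {i} p = trans (finToFun-funToFin _ i)
      (cong (if_then 1F else 0F) (dec-true (P? i) p))

    encode⁻ : ∀ {i} → encode P? ∋ i → P i
    -- Abstracting `P? i` together with the digit equation turns the latter into `0F ≡ 1F` in the
    -- `no` case.
    encode⁻ {i} h with P? i | trans (sym (finToFun-funToFin (λ j → if does (P? j) then 1F else 0F) i)) h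
    ... | yes p | _ = p
    ... | no  _ | ()

  singleton cosingleton : Fin k → Vertex
  singleton   i = encode (i ≟_)
  cosingleton i = encode (λ j → ¬? (i ≟ j))

  full : Vertex
  full = encode U?

  full-∋ : ∀ i → full ∋ i
  full-∋ i = encode⁺ U? {i} _

  cosingleton-∋ : ∀ i j → i ≢ j → cosingleton i ∋ j
  cosingleton-∋ i j = encode⁺ (λ j → ¬? (i ≟ j)) {j}

  cosingleton-∌ : ∀ i → ¬ (cosingleton i ∋ i)
  cosingleton-∌ i i∋i = encode⁻ (λ j → ¬? (i ≟ j)) {i} i∋i refl

  singleton-∋ : ∀ i → singleton i ∋ i
  singleton-∋ i = encode⁺ (i ≟_) refl

  singleton-injective : Injective _≡_ _≡_ singleton
  singleton-injective {i} {j} eq =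
    sym (encode⁻ (j ≟_) (subst (_∋ i) eq (singleton-∋ i)))

  -- One direction of the adjacency condition; it is vacuous unless `x` is a singleton.
  Compatible : Vertex → Vertex → Set
  Compatible x y = ∀ i → x ≡ singleton i → y ∋ i

  G : Graph (2 ^ k)
  G = record
    { Adj    = λ x y → x ≢ y × Compatible x y × Compatible y x
    ; adj?   = λ x y → ¬? (x ≟ y) ×-dec compatible? x y ×-dec compatible? y x
    ; sym    = λ (x≢y , xy , yx) → x≢y ∘ sym , yx , xy
    ; irrefl = λ x≡y (x≢y , _) → x≢y x≡y
    }
    where
    compatible? : ∀ x y → Dec (Compatible x y)
    compatible? x y = all? λ i → (x ≟ singleton i) →-dec (finToFun {2} {k} y i ≟ 1F)

  compatible⇒∈N : ∀ {x y} → Compatible x y → Compatible y x → y ∈ N[ G ] x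
  compatible⇒∈N {x} {y} xy yx with y ≟ x
  ... | yes y≡x = ∈N⁺ G x (inj₁ y≡x)
  ... | no  y≢x = ∈N⁺ G x (inj₂ (y≢x ∘ sym , xy , yx))

  -- If `x` is itself a singleton, containing `i` forces it to be `singleton i`, so compatibility
  -- holds in both directions.
  ∋⇒singleton∈N : ∀ x {i} → x ∋ i → singleton i ∈ N[ G ] x
  ∋⇒singleton∈N x {i} x∋i = compatible⇒∈N
    (λ j x≡j → subst (singleton i ∋_)
      (sym (encode⁻ (j ≟_) (subst (_∋ i) x≡j x∋i))) (singleton-∋ i))
    (λ j i≡j → subst (x ∋_) (singleton-injective i≡j) x∋i)

  singleton∈N⇒∋ : ∀ x {i} → singleton i ∈ N[ G ] x → x ∋ i
  singleton∈N⇒∋ x {i} i∈N with ∈N⁻ G x i∈N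
  ... | inj₁ i≡x          = subst (_∋ i) i≡x (singleton-∋ i)
  ... | inj₂ (_ , _ , yx) = yx i refl

  -- By the two preceding lemmas, the singletons in a closed neighbourhood spell out the elements of
  -- its centre. This yields both twin-freeness and the upper bound.
  singletons-locate : ∀ x y → (∀ i → singleton i ∈ N[ G ] x → singleton i ∈ N[ G ] y) →
                      (∀ i → singleton i ∈ N[ G ] y → singleton i ∈ N[ G ] x) → x ≡ y
  singletons-locate x y xy yx = ∋-ext
    (λ i → singleton∈N⇒∋ y ∘ xy i ∘ ∋⇒singleton∈N x)
    (λ i → singleton∈N⇒∋ x ∘ yx i ∘ ∋⇒singleton∈N y)

  twinFree : TwinFree G
  twinFree x y x≢y eq = x≢y (singletons-locate x y
    (λ i → subst (singleton i ∈_) eq) (λ i → subst (singleton i ∈_) (sym eq)))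

  singletons : Subset (2 ^ k)
  singletons = image singleton

  ∣singletons∣ : ∣ singletons ∣ ≡ k
  ∣singletons∣ = ≤-antisym (∣image∣≤ singleton)
    (injective⇒≤∣p∣ singleton singleton-injective singletons (∈-image singleton))

  singletons-separating : (c : Colouring G) → RBSeparating G c singletons
  singletons-separating c r b cr cb eq with trans (sym cr) (trans (cong c r≡b) cb)
    where
    r≡b : r ≡ b
    r≡b = singletons-locate r b
      (λ i → ∩-≡⇒∈ eq (∈-image singleton i)) (λ i → ∩-≡⇒∈ (sym eq) (∈-image singleton i))
  ... | ()

  fullRed : Colouring G
  fullRed x = if does (x ≟ full) then red else blue

  LowerBound : Set
  LowerBound = ∀ T → RBSeparating G fullRed T → k ≤ ∣ T ∣

  -- The set `singletons` separates every colouring, so no value exceeds `k`; only attaining `k` at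
  -- `fullRed` depends on the lower bound.
  maxSep : LowerBound → maxSepRB G ≔ k
  maxSep lower =
    (fullRed , (singletons , singletons-separating fullRed , ∣singletons∣)
             , λ { (T , sep , refl) → lower T sep }) ,
    λ { (c , _ , least) → least (singletons , singletons-separating c , ∣singletons∣) }

  two-elements⇒≢singleton : ∀ {x i j} → i ≢ j → x ∋ i → x ∋ j → ∀ l → x ≢ singleton l
  two-elements⇒≢singleton {i = i} {j} i≢j x∋i x∋j l x≡l =
    i≢j (trans (sym (encode⁻ (l ≟_) (subst (_∋ i) x≡l x∋i)))
               (encode⁻ (l ≟_) (subst (_∋ j) x≡l x∋j)))

  -- When `y` is not a singleton, `z` can fail to lie in its closed neighbourhood only by being a
  -- singleton whose element is missing from `y`.
  N-transfer : ∀ {x y z} → (∀ l → y ≢ singleton l) →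
               (∀ j → z ≡ singleton j → x ∋ j → y ∋ j) →
               z ∈ N[ G ] x → z ∈ N[ G ] y
  N-transfer {x} {y} {z} y-big h z∈Nx = compatible⇒∈N
    (λ l y≡l → contradiction y≡l (y-big l))
    (λ j z≡j → h j z≡j (singleton∈N⇒∋ x (subst (_∈ N[ G ] x) z≡j z∈Nx)))

-- Lower bound for at least three elements.

module _ (m : ℕ) where
  open Construction (3 + m)

  private
    cosingleton-big : ∀ i l → cosingleton i ≢ singleton l
    -- `punchIn i` skips `i`, so its values at `0F` and `1F` are two distinct elements of the
    -- complement; they exist because the ground set has at least three elements.
    cosingleton-big i = two-elements⇒≢singleton {i = punchIn i 0F} {j = punchIn i 1F}
      (λ eq → contradiction (punchIn-injective i 0F 1F eq) λ ())
      (cosingleton-∋ i (punchIn i 0F) (punchInᵢ≢i i 0F ∘ sym))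
      (cosingleton-∋ i (punchIn i 1F) (punchInᵢ≢i i 1F ∘ sym))

    full-big : ∀ l → full ≢ singleton l
    full-big = two-elements⇒≢singleton {i = 0F} {j = 1F} (λ ()) (full-∋ 0F) (full-∋ 1F)

    cosingleton≢full : ∀ i → cosingleton i ≢ full
    cosingleton≢full i eq = cosingleton-∌ i (subst (_∋ i) (sym eq) (full-∋ i))

  separating⇒singleton∈ : ∀ T → RBSeparating G fullRed T → ∀ i → singleton i ∈ T
  separating⇒singleton∈ T sep i = decidable-stable (singleton i ∈? T) λ i∉T →
    sep full (cosingleton i)
      (cong (if_then red else blue) (dec-true (full ≟ full) refl))
      (cong (if_then red else blue) (dec-false (cosingleton i ≟ full) (cosingleton≢full i)))
      (⊆-antisym
        -- A singleton `z` in `T` has an element `j` different from `i`, as `singleton i` is not in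
        -- `T`; hence `j` lies in the complement of `i`.
        (∩-cong-∈ λ z∈T → N-transfer (cosingleton-big i) λ j z≡j _ →
          cosingleton-∋ i j λ { refl → i∉T (subst (_∈ T) z≡j z∈T) })
        (∩-cong-∈ λ _ → N-transfer full-big λ j _ _ → full-∋ j))

  lowerBound-≥3 : LowerBound
  lowerBound-≥3 T sep =
    injective⇒≤∣p∣ singleton singleton-injective T (separating⇒singleton∈ T sep)

-- Lower bound for one and two elements.

lowerBound-1 : Construction.LowerBound 1
-- The red vertex `1F` is the full set and `0F` the empty set; both have an empty trace here.
lowerBound-1 (outside ∷ outside ∷ []) sep = contradiction refl (sep 1F 0F refl refl)
lowerBound-1 (outside ∷ inside  ∷ []) sep = s≤s z≤n
lowerBound-1 (inside  ∷ _       ∷ []) sep = s≤s z≤n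

-- Here G is the star with centre 3F (the full set).
lowerBound-2 : Construction.LowerBound 2
-- The first five clauses are the sets with at most one vertex. The centre and a leaf both have that
-- leaf and the centre in their closed neighbourhoods, so a lone leaf is compared with the centre,
-- and otherwise any leaf serves.
lowerBound-2 (outside ∷ outside ∷ outside ∷ outside ∷ []) sep = contradiction refl (sep 3F 0F refl refl)
lowerBound-2 (outside ∷ outside ∷ outside ∷ inside  ∷ []) sep = contradiction refl (sep 3F 0F refl refl)
lowerBound-2 (outside ∷ outside ∷ inside  ∷ outside ∷ []) sep = contradiction refl (sep 3F 2F refl refl)
lowerBound-2 (outside ∷ inside  ∷ outside ∷ outside ∷ []) sep = contradiction refl (sep 3F 1F refl refl)
lowerBound-2 (inside  ∷ outside ∷ outside ∷ outside ∷ []) sep = contradiction refl (sep 3F 0F refl refl)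
lowerBound-2 (outside ∷ outside ∷ inside  ∷ inside  ∷ []) sep = s≤s (s≤s z≤n)
lowerBound-2 (outside ∷ inside  ∷ outside ∷ inside  ∷ []) sep = s≤s (s≤s z≤n)
lowerBound-2 (outside ∷ inside  ∷ inside  ∷ _       ∷ []) sep = s≤s (s≤s z≤n)
lowerBound-2 (inside  ∷ outside ∷ outside ∷ inside  ∷ []) sep = s≤s (s≤s z≤n)
lowerBound-2 (inside  ∷ outside ∷ inside  ∷ _       ∷ []) sep = s≤s (s≤s z≤n)
lowerBound-2 (inside  ∷ inside  ∷ _       ∷ _       ∷ []) sep = s≤s (s≤s z≤n)

proposition9 : (k : ℕ) → k ≥ 1 → Σ[ G ∈ Graph (2 ^ k) ] (TwinFree G × (maxSepRB G ≔ k))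
proposition9 k k≥1 = G , twinFree , maxSep (lower k k≥1)
  where
  open Construction k
  lower : ∀ k → k ≥ 1 → Construction.LowerBound k
  lower 1                   _ = lowerBound-1
  lower 2                   _ = lowerBound-2
  lower (suc (suc (suc m))) _ = lowerBound-≥3 m
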